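{- If a normal modal logic (over a finite alphabet of modalities) admits the finite height criterion, then it admits the 1-finiteness condition.
   Context: Normal logic over a finite alphabet $\mathrm{Al}$ of unary modalities (contains tautologies, $\neg\Diamond\bot$, $\Diamond(p_0\vee p_1)\to\Diamond p_0\vee\Diamond p_1$, closed under modus ponens, substitution, monotonicity); an extension of $L_0$ is a normal logic over the same alphabet containing $L_0$. For $\mathrm C\subseteq\mathrm{Al}$, $L^{\restriction\mathrm C}$ is the set of formulas over $\mathrm C$ in $L$. $L$ is $k$-finite if it has only finitely many pairwise $L$-nonequivalent formulas in variables $p_0,\dots,p_{k-1}$; locally tabular if $k$-finite for all $k<\omega$. For a logic $L$ over $\mathrm C$: $\Diamond_{\mathrm C}\varphi=\bigvee_{\Diamond\in\mathrm C}\Diamond\varphi$, $\Diamond^{\le m}_{\mathrm C}\varphi=\bigvee_{i\le m}\Diamond^i_{\mathrm C}\varphi$; $\mathrm{tra}(L)$ is the least $m$ with $\Diamond^{m+1}_{\mathrm C}p\to\Diamond^{\le m}_{\mathrm C}p\in L$ ($\omega$ if none). If $\mathrm{tra}(L)=m<\omega$, $\Diamond^*=\Diamond^{\le m}_{\mathrm C}$; $B_0=\bot$, $B_h=p_h\to\Box(\Diamond p_h\vee B_{h-1})$, and $B^*_h$ is $B_h$ with $\Diamond,\Box$ replaced by $\Diamond^*,\neg\Diamond^*\neg$. The height $h(L)$ is the least $h$ with $B^*_h\in L$ ($\omega$ if none or if $L$ is not pretransitive). $L_0$ over $\mathrm{Al}$ admits the finite height criterion if for every extension $L$ of $L_0$: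 $L$ is locally tabular iff $h(L^{\restriction\mathrm C})<\omega$ for all $\mathrm C\subseteq\mathrm{Al}$. $L_0$ admits the 1-finiteness condition if every 1-finite extension of $L_0$ is locally tabular. -}

module Defs where

open import Data.Nat using (ℕ; zero; suc; _<_)
open import Data.Bool using (Bool; true; false; if_then_else_; not; _∧_)
open import Data.Fin using (Fin)
open import Data.Fin.Subset using (Subset; _∈_)
open import Data.Fin.Subset.Properties using (_∈?_)
open import Data.List using (List; []; _∷_; foldr; map; filter; allFin)
open import Data.List.Membership.Propositional using () renaming (_∈_ to _∈ˡ_)
open import Data.Product using (Σ; _×_; _,_)
open import Relation.Binary.PropositionalEquality using (_≡_)
open import Relation.Nullary using (¬_)
open import Relation.Unary using (Pred; _⊆_)
open import Level using (0ℓ)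

data Fm (A : Set) : Set where
  var  : ℕ → Fm A
  ⊥'   : Fm A
  _⇒_  : Fm A → Fm A → Fm A
  ◇    : A → Fm A → Fm A

infixr 4 _⇒_

module _ {A : Set} where

  ¬' : Fm A → Fm A
  ¬' φ = φ ⇒ ⊥'

  ⊤' : Fm A
  ⊤' = ¬' ⊥'

  _∨'_ : Fm A → Fm A → Fm A
  φ ∨' ψ = ¬' φ ⇒ ψ

  _∧'_ : Fm A → Fm A → Fm A
  φ ∧' ψ = ¬' (φ ⇒ ¬' ψ)

  _⇔'_ : Fm A → Fm A → Fm A
  φ ⇔' ψ = (φ ⇒ ψ) ∧' (ψ ⇒ φ)

  ⋁ : List (Fm A) → Fm A
  ⋁ = foldr _∨'_ ⊥'

  -- Classical (Boolean) evaluation, treating variables and ◇-subformulas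
  -- as propositional atoms whose values are given by v.
  eval : (Fm A → Bool) → Fm A → Bool
  eval v (var i)   = v (var i)
  eval v ⊥'        = false
  eval v (φ ⇒ ψ)   = not (eval v φ) Data.Bool.∨ eval v ψ
  eval v (◇ a φ)   = v (◇ a φ)

  Tautology : Fm A → Set
  Tautology φ = (v : Fm A → Bool) → eval v φ ≡ true

  sub : (ℕ → Fm A) → Fm A → Fm A
  sub σ (var i)  = σ i
  sub σ ⊥'       = ⊥'
  sub σ (φ ⇒ ψ)  = sub σ φ ⇒ sub σ ψ
  sub σ (◇ a φ)  = ◇ a (sub σ φ)

  VarsBelow : ℕ → Fm A → Set
  VarsBelow k (var i)  = i < k
  VarsBelow k ⊥'       = Data.Unit.⊤ where import Data.Unit
  VarsBelow k (φ ⇒ ψ)  = VarsBelow k φ × VarsBelow k ψ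
  VarsBelow k (◇ a φ)  = VarsBelow k φ

p : {A : Set} → ℕ → Fm A
p = var

Logic : ℕ → Set₁
Logic n = Pred (Fm (Fin n)) 0ℓ

record Normal {n : ℕ} (L : Logic n) : Set where
  field
    taut  : ∀ φ → Tautology φ → L φ
    dual  : ∀ a → L (¬' (◇ a ⊥'))
    distr : ∀ a → L ((◇ a (p 0 ∨' p 1)) ⇒ (◇ a (p 0) ∨' ◇ a (p 1)))
    mp    : ∀ φ ψ → L φ → L (φ ⇒ ψ) → L ψ
    subst : ∀ σ φ → L φ → L (sub σ φ)
    mono  : ∀ a φ ψ → L (φ ⇒ ψ) → L (◇ a φ ⇒ ◇ a ψ)

record Extension {n : ℕ} (L₀ L : Logic n) : Set where
  field
    normal   : Normal L
    contains : L₀ ⊆ L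

_≈[_]_ : {n : ℕ} → Fm (Fin n) → Logic n → Fm (Fin n) → Set
φ ≈[ L ] ψ = L (φ ⇔' ψ)

-- k-finite: finitely many pairwise L-nonequivalent formulas in p₀,…,p_{k-1},
-- i.e. there is a finite list of such formulas such that every formula in
-- p₀,…,p_{k-1} is L-equivalent to one of them.
KFinite : {n : ℕ} → Logic n → ℕ → Set
KFinite {n} L k =
  Σ (List (Fm (Fin n))) λ reps →
    ((ψ : Fm (Fin n)) → ψ ∈ˡ reps → VarsBelow k ψ) ×
    ((φ : Fm (Fin n)) → VarsBelow k φ →
       Σ (Fm (Fin n)) λ ψ → (ψ ∈ˡ reps) × (φ ≈[ L ] ψ))

LocallyTabular : {n : ℕ} → Logic n → Set
LocallyTabular L = ∀ k → KFinite L k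

-- Restriction to a sub-alphabet C ⊆ Fin n, pretransitivity and height.
-- The restriction L^{↾C} is the set of formulas of L whose modalities lie in C;
-- all formulas below only use modalities from C, so membership in L^{↾C}
-- is the same as membership in L.

module _ {n : ℕ} (C : Subset n) where

  elemsC : List (Fin n)
  elemsC = filter (_∈? C) (allFin n)

  ◇C : Fm (Fin n) → Fm (Fin n)
  ◇C φ = ⋁ (map (λ a → ◇ a φ) elemsC)

  ◇C^ : ℕ → Fm (Fin n) → Fm (Fin n)
  ◇C^ zero    φ = φ
  ◇C^ (suc i) φ = ◇C (◇C^ i φ)

  ◇C≤ : ℕ → Fm (Fin n) → Fm (Fin n)
  ◇C≤ zero    φ = φ
  ◇C≤ (suc m) φ = ◇C≤ m φ ∨' ◇C^ (suc m) φ

  TraAx : ℕ → Fm (Fin n)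
  TraAx m = ◇C^ (suc m) (p 0) ⇒ ◇C≤ m (p 0)

  TraIs : Logic n → ℕ → Set
  TraIs L m = L (TraAx m) × (∀ m' → m' < m → ¬ L (TraAx m'))

  -- B*_h with ◇* = ◇_C^{≤ m} and □* = ¬◇*¬
  B* : ℕ → ℕ → Fm (Fin n)
  B* m zero    = ⊥'
  B* m (suc h) = p (suc h) ⇒ ¬' (◇C≤ m (¬' (◇C≤ m (p (suc h)) ∨' B* m h)))

  FiniteHeight : Logic n → Set
  FiniteHeight L = Σ ℕ λ m → TraIs L m × Σ ℕ λ h → L (B* m h)

FiniteHeightCriterion : {n : ℕ} → Logic n → Set₁
FiniteHeightCriterion {n} L₀ =
  (L : Logic n) → Extension L₀ L →
    (LocallyTabular L → (C : Subset n) → FiniteHeight C L) ×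
    (((C : Subset n) → FiniteHeight C L) → LocallyTabular L)

OneFinitenessCondition : {n : ℕ} → Logic n → Set₁
OneFinitenessCondition {n} L₀ =
  (L : Logic n) → Extension L₀ L → KFinite L 1 → LocallyTabular L

{-# OPTIONS --safe #-}
-- Let L be a 1-finite extension of L₀ and let L₁ consist of the formulas all of
-- whose one-variable substitution instances lie in L: it is the logic of the
-- one-generated free algebra of L.  That algebra is finite, so L₁ is locally
-- tabular, and the criterion gives the exact value m of tra(L₁); since L and L₁
-- have the same one-variable formulas, tra(L) = m.  (Going through L₁ also avoids
-- a search for the least m, as membership in L need not be decidable.)
--
-- For the height of L, let u_j say that a refutation of B*_j is accessible, and
-- let a point have level j when u_j holds and u_{j+1} fails.  A point of level
-- j + 1 or more sees a point of level exactly j, so the level behaves like a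
-- p-morphism onto a chain.  Let E_j(x) say that j steps along ◇* are possible with
-- alternating values of x.  If x is the parity of the level, E_j(x) holds at level
-- j and implies u_j.  By 1-finiteness E_i(x) → E_{i+1}(x) is in L for some i, so
-- level i is empty, and hence so is u_{i+1}, that is, B*_{i+1} ∈ L.
module Submission where

open import Data.Nat using (ℕ; zero; suc; _<_; _≤_; z≤n; s≤s; _^_; _<?_; _≤′_; ≤′-refl; ≤′-step)
open import Data.Nat.Properties using (≤-trans; ≤⇒≤′; ≤′⇒≤; ≤-refl; n≤1+n; n<1+n)
open import Data.Nat.Induction using (<-wellFounded)
open import Induction.WellFounded using (Acc; acc)
open import Data.Bool using (Bool; true; false; T; not; _∧_)
open import Data.Bool.Properties using (T-∧; T-≡)
open import Data.Fin as Fin using (Fin; toℕ; fromℕ<; funToFin; finToFun)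
open import Data.Fin.Properties using (finToFun-funToFin; pigeonhole; toℕ-fromℕ<; toℕ<n; _≟_)
open import Data.Fin.Subset using (Subset)
open import Data.List using (List; []; _∷_; _++_; map; filter; allFin; length; lookup; cartesianProductWith)
open import Data.List.Properties using (filter-notAll)
open import Data.List.Membership.Propositional using (_∈_; lose; find)
open import Data.List.Membership.Propositional.Properties
  using (∈-++⁺ˡ; ∈-++⁺ʳ; ∈-map⁺; ∈-allFin; ∈-lookup; ∈-filter⁺; ∈-cartesianProductWith⁺)
open import Data.List.Relation.Unary.Any as Any using (Any; here; there; any?)
import Data.List.Relation.Unary.Any.Properties as Any
open import Data.List.Relation.Unary.All as All using (All; []; _∷_; all?)
import Data.List.Relation.Unary.All.Properties as All
open import Data.Vec as Vec using (Vec; []; _∷_)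
open import Data.Product using (Σ; _×_; _,_; proj₁; proj₂; ∃)
open import Data.Sum using (_⊎_; inj₁; inj₂)
open import Data.Unit using (tt)
open import Function using (_∘_; Equivalence)
open import Relation.Binary.PropositionalEquality
  using (_≡_; _≗_; refl; sym; trans; cong; cong₂; subst; subst₂; setoid)
open import Relation.Nullary using (yes; no; contradiction; ¬?)
open import Defs

-- Truth tables

nth : ∀ {X : Set} {k} → X → Vec X k → ℕ → X
nth d []       _       = d
nth d (x ∷ xs) zero    = x
nth d (x ∷ xs) (suc i) = nth d xs i

nth-map : ∀ {X Y : Set} (f : X → Y) {d k} (xs : Vec X k) i →
          f (nth d xs i) ≡ nth (f d) (Vec.map f xs) i
nth-map f []       i       = refl
nth-map f (x ∷ xs) zero    = refl
nth-map f (x ∷ xs) (suc i) = nth-map f xs i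

-- Propositional schemes are formulas over the empty alphabet, so no case for `◇` arises. The
-- default `⊥'` evaluates to `false`, the default of `row`.
inst : ∀ {A : Set} {k} → Vec (Fm A) k → Fm (Fin 0) → Fm A
inst φs (var i) = nth ⊥' φs i
inst φs ⊥'      = ⊥'
inst φs (χ ⇒ θ) = inst φs χ ⇒ inst φs θ

row : ∀ {k} → Vec Bool k → Fm (Fin 0) → Bool
row bs (var i) = nth false bs i
row bs _       = false

table : ∀ k → (Vec Bool k → Bool) → Bool
table zero    f = f []
table (suc k) f = table k (f ∘ (true ∷_)) ∧ table k (f ∘ (false ∷_))

table-sound : ∀ {k} (f : Vec Bool k → Bool) → T (table k f) → ∀ bs → T (f bs)
table-sound f t []           = t
table-sound f t (true  ∷ bs) = table-sound _ (proj₁ (Equivalence.to T-∧ t)) bs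
table-sound {suc k} f t (false ∷ bs) =
  table-sound _ (proj₂ (Equivalence.to (T-∧ {table k (f ∘ (true ∷_))}) t)) bs

eval-inst : ∀ {A : Set} {k} v (φs : Vec (Fm A) k) χ →
            eval v (inst φs χ) ≡ eval (row (Vec.map (eval v) φs)) χ
eval-inst v φs (var i) = nth-map (eval v) φs i
eval-inst v φs ⊥'      = refl
eval-inst v φs (χ ⇒ θ) =
  cong₂ (λ a b → not a Data.Bool.∨ b) (eval-inst v φs χ) (eval-inst v φs θ)

inst-tautology : ∀ {A : Set} {k} (χ : Fm (Fin 0)) (φs : Vec (Fm A) k) →
                 T (table k (λ bs → eval (row bs) χ)) → Tautology (inst φs χ)
inst-tautology χ φs t v = trans (eval-inst v φs χ)
  (Equivalence.to T-≡ (table-sound (λ bs → eval (row bs) χ) t (Vec.map (eval v) φs)))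

-- Substitution and variables

sub-sub : ∀ {A : Set} (σ τ : ℕ → Fm A) φ → sub σ (sub τ φ) ≡ sub (sub σ ∘ τ) φ
sub-sub σ τ (var i) = refl
sub-sub σ τ ⊥'      = refl
sub-sub σ τ (φ ⇒ ψ) = cong₂ _⇒_ (sub-sub σ τ φ) (sub-sub σ τ ψ)
sub-sub σ τ (◇ a φ) = cong (◇ a) (sub-sub σ τ φ)

sub-var : ∀ {A : Set} {k} (σ : ℕ → Fm A) → (∀ i → i < k → σ i ≡ var i) →
          ∀ φ → VarsBelow k φ → sub σ φ ≡ φ
sub-var σ h (var i) b       = h i b
sub-var σ h ⊥'      b       = refl
sub-var σ h (φ ⇒ ψ) (b , c) = cong₂ _⇒_ (sub-var σ h φ b) (sub-var σ h ψ c)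
sub-var σ h (◇ a φ) b       = cong (◇ a) (sub-var σ h φ b)

VarsBelow-sub : ∀ {A : Set} {k} (σ : ℕ → Fm A) → (∀ i → VarsBelow k (σ i)) →
                ∀ φ → VarsBelow k (sub σ φ)
VarsBelow-sub σ h (var i) = h i
VarsBelow-sub σ h ⊥'      = tt
VarsBelow-sub σ h (φ ⇒ ψ) = VarsBelow-sub σ h φ , VarsBelow-sub σ h ψ
VarsBelow-sub σ h (◇ a φ) = VarsBelow-sub σ h φ

module _ {n : ℕ} (C : Subset n) where

  sub-◇C : ∀ σ φ → sub σ (◇C C φ) ≡ ◇C C (sub σ φ)
  sub-◇C σ φ = go (elemsC C)
    where
    go : ∀ as → sub σ (⋁ (map (λ a → ◇ a φ) as)) ≡ ⋁ (map (λ a → ◇ a (sub σ φ)) as)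
    go []       = refl
    go (a ∷ as) = cong (◇ a (sub σ φ) ∨'_) (go as)

  sub-◇C^ : ∀ σ i φ → sub σ (◇C^ C i φ) ≡ ◇C^ C i (sub σ φ)
  sub-◇C^ σ zero    φ = refl
  sub-◇C^ σ (suc i) φ = trans (sub-◇C σ (◇C^ C i φ)) (cong (◇C C) (sub-◇C^ σ i φ))

  sub-◇C≤ : ∀ σ m φ → sub σ (◇C≤ C m φ) ≡ ◇C≤ C m (sub σ φ)
  sub-◇C≤ σ zero    φ = refl
  sub-◇C≤ σ (suc m) φ = cong₂ _∨'_ (sub-◇C≤ σ m φ) (sub-◇C^ σ (suc m) φ)

  VarsBelow-◇C : ∀ {k} φ → VarsBelow k φ → VarsBelow k (◇C C φ)
  VarsBelow-◇C {k} φ b = go (elemsC C)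
    where
    go : ∀ as → VarsBelow k (⋁ (map (λ a → ◇ a φ) as))
    go []       = tt
    go (a ∷ as) = (b , tt) , go as

  VarsBelow-◇C^ : ∀ {k} i φ → VarsBelow k φ → VarsBelow k (◇C^ C i φ)
  VarsBelow-◇C^ zero    φ b = b
  VarsBelow-◇C^ (suc i) φ b = VarsBelow-◇C (◇C^ C i φ) (VarsBelow-◇C^ i φ b)

  VarsBelow-◇C≤ : ∀ {k} m φ → VarsBelow k φ → VarsBelow k (◇C≤ C m φ)
  VarsBelow-◇C≤ zero    φ b = b
  VarsBelow-◇C≤ (suc m) φ b = (VarsBelow-◇C≤ m φ b , tt) , VarsBelow-◇C^ (suc m) φ b

  VarsBelow-TraAx : ∀ m → VarsBelow 1 (TraAx C m)
  VarsBelow-TraAx m = VarsBelow-◇C^ (suc m) (p 0) (s≤s z≤n) , VarsBelow-◇C≤ m (p 0) (s≤s z≤n)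

-- Normal logics

module Derive {n : ℕ} {L : Logic n} (N : Normal L) where
  open Normal N renaming (subst to substitution)

  infix 3 _⊢_

  _⊢_ : Fm (Fin n) → Fm (Fin n) → Set
  φ ⊢ ψ = L (φ ⇒ ψ)

  -- For a concrete tautology `χ` the truth table computes to `true`, so the hidden argument has the
  -- unit type and is filled in automatically.
  prop : ∀ {k} χ (φs : Vec (Fm (Fin n)) k) {_ : T (table k (λ bs → eval (row bs) χ))} →
         L (inst φs χ)
  prop χ φs {t} = taut _ (inst-tautology χ φs t)

  infixl 4 _·_

  _·_ : ∀ {φ ψ} → L (φ ⇒ ψ) → L φ → L ψ
  f · x = mp _ _ x f

  ⊢-refl : ∀ {φ} → φ ⊢ φ
  ⊢-refl {φ} = prop (p 0 ⇒ p 0) (φ ∷ [])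

  ⊢-trans : ∀ {φ ψ χ} → φ ⊢ ψ → ψ ⊢ χ → φ ⊢ χ
  ⊢-trans {φ} {ψ} {χ} d e =
    prop ((p 0 ⇒ p 1) ⇒ (p 1 ⇒ p 2) ⇒ p 0 ⇒ p 2) (φ ∷ ψ ∷ χ ∷ []) · d · e

  ∨-introˡ : ∀ {φ ψ} → φ ⊢ φ ∨' ψ
  ∨-introˡ {φ} {ψ} = prop (p 0 ⇒ p 0 ∨' p 1) (φ ∷ ψ ∷ [])

  ∨-introʳ : ∀ {φ ψ} → ψ ⊢ φ ∨' ψ
  ∨-introʳ {φ} {ψ} = prop (p 1 ⇒ p 0 ∨' p 1) (φ ∷ ψ ∷ [])

  ∨-elim : ∀ {φ ψ χ} → φ ⊢ χ → ψ ⊢ χ → φ ∨' ψ ⊢ χ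
  ∨-elim {φ} {ψ} {χ} d e =
    prop ((p 0 ⇒ p 2) ⇒ (p 1 ⇒ p 2) ⇒ p 0 ∨' p 1 ⇒ p 2) (φ ∷ ψ ∷ χ ∷ []) · d · e

  ∧-intro : ∀ {φ ψ χ} → χ ⊢ φ → χ ⊢ ψ → χ ⊢ φ ∧' ψ
  ∧-intro {φ} {ψ} {χ} d e =
    prop ((p 2 ⇒ p 0) ⇒ (p 2 ⇒ p 1) ⇒ p 2 ⇒ p 0 ∧' p 1) (φ ∷ ψ ∷ χ ∷ []) · d · e

  ∧-elimˡ : ∀ {φ ψ} → φ ∧' ψ ⊢ φ
  ∧-elimˡ {φ} {ψ} = prop (p 0 ∧' p 1 ⇒ p 0) (φ ∷ ψ ∷ [])

  ∧-elimʳ : ∀ {φ ψ} → φ ∧' ψ ⊢ ψ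
  ∧-elimʳ {φ} {ψ} = prop (p 0 ∧' p 1 ⇒ p 1) (φ ∷ ψ ∷ [])

  contrapose : ∀ {φ ψ} → φ ⊢ ψ → ¬' ψ ⊢ ¬' φ
  contrapose {φ} {ψ} d = prop ((p 0 ⇒ p 1) ⇒ ¬' (p 1) ⇒ ¬' (p 0)) (φ ∷ ψ ∷ []) · d

  infix 3 _≈_

  _≈_ : Fm (Fin n) → Fm (Fin n) → Set
  φ ≈ ψ = φ ≈[ L ] ψ

  ≈-intro : ∀ {φ ψ} → φ ⊢ ψ → ψ ⊢ φ → φ ≈ ψ
  ≈-intro {φ} {ψ} d e =
    prop ((p 0 ⇒ p 1) ⇒ (p 1 ⇒ p 0) ⇒ p 0 ⇔' p 1) (φ ∷ ψ ∷ []) · d · e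

  ≈⇒⊢ : ∀ {φ ψ} → φ ≈ ψ → φ ⊢ ψ
  ≈⇒⊢ {φ} {ψ} e = prop (p 0 ⇔' p 1 ⇒ (p 0 ⇒ p 1)) (φ ∷ ψ ∷ []) · e

  ≈-sym : ∀ {φ ψ} → φ ≈ ψ → ψ ≈ φ
  ≈-sym {φ} {ψ} e = prop (p 0 ⇔' p 1 ⇒ p 1 ⇔' p 0) (φ ∷ ψ ∷ []) · e

  ≈-trans : ∀ {φ ψ χ} → φ ≈ ψ → ψ ≈ χ → φ ≈ χ
  ≈-trans {φ} {ψ} {χ} d e =
    prop (p 0 ⇔' p 1 ⇒ p 1 ⇔' p 2 ⇒ p 0 ⇔' p 2) (φ ∷ ψ ∷ χ ∷ []) · d · e

  ⇒-cong : ∀ {φ φ′ ψ ψ′} → φ ≈ φ′ → ψ ≈ ψ′ → (φ ⇒ ψ) ≈ (φ′ ⇒ ψ′)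
  ⇒-cong {φ} {φ′} {ψ} {ψ′} d e =
    prop (p 0 ⇔' p 1 ⇒ p 2 ⇔' p 3 ⇒ (p 0 ⇒ p 2) ⇔' (p 1 ⇒ p 3)) (φ ∷ φ′ ∷ ψ ∷ ψ′ ∷ []) · d · e

  ◇-cong : ∀ {a φ ψ} → φ ≈ ψ → ◇ a φ ≈ ◇ a ψ
  ◇-cong e = ≈-intro (mono _ _ _ (≈⇒⊢ e)) (mono _ _ _ (≈⇒⊢ (≈-sym e)))

  ∨-mono : ∀ {φ φ′ ψ ψ′} → φ ⊢ φ′ → ψ ⊢ ψ′ → φ ∨' ψ ⊢ φ′ ∨' ψ′
  ∨-mono d e = ∨-elim (⊢-trans d ∨-introˡ) (⊢-trans e ∨-introʳ)

  ◇-∨ : ∀ a φ ψ → ◇ a (φ ∨' ψ) ⊢ ◇ a φ ∨' ◇ a ψ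
  ◇-∨ a φ ψ = substitution (nth ⊥' (φ ∷ ψ ∷ [])) _ (distr a)

  -- The compound modalities of a subalphabet

  module _ (C : Subset n) where

    ◇C-mono : ∀ {φ ψ} → φ ⊢ ψ → ◇C C φ ⊢ ◇C C ψ
    ◇C-mono {φ} {ψ} d = go (elemsC C)
      where
      go : ∀ as → ⋁ (map (λ a → ◇ a φ) as) ⊢ ⋁ (map (λ a → ◇ a ψ) as)
      go []       = ⊢-refl
      go (a ∷ as) = ∨-mono (mono a _ _ d) (go as)

    ◇C-∨ : ∀ φ ψ → ◇C C (φ ∨' ψ) ⊢ ◇C C φ ∨' ◇C C ψ
    ◇C-∨ φ ψ = go (elemsC C)
      where
      go : ∀ as → ⋁ (map (λ a → ◇ a (φ ∨' ψ)) as) ⊢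
                  ⋁ (map (λ a → ◇ a φ) as) ∨' ⋁ (map (λ a → ◇ a ψ) as)
      go []       = ∨-introˡ
      go (a ∷ as) = ∨-elim
        (⊢-trans (◇-∨ a φ ψ) (∨-mono ∨-introˡ ∨-introˡ))
        (⊢-trans (go as) (∨-mono ∨-introʳ ∨-introʳ))

    ◇C-⊥ : ◇C C ⊥' ⊢ ⊥'
    ◇C-⊥ = go (elemsC C)
      where
      go : ∀ as → ⋁ (map (λ a → ◇ a ⊥') as) ⊢ ⊥'
      go []       = ⊢-refl
      go (a ∷ as) = ∨-elim (dual a) (go as)

    ◇C^-mono : ∀ i {φ ψ} → φ ⊢ ψ → ◇C^ C i φ ⊢ ◇C^ C i ψ
    ◇C^-mono zero    d = d
    ◇C^-mono (suc i) d = ◇C-mono (◇C^-mono i d)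

    ◇C≤-mono : ∀ m {φ ψ} → φ ⊢ ψ → ◇C≤ C m φ ⊢ ◇C≤ C m ψ
    ◇C≤-mono zero    d = d
    ◇C≤-mono (suc m) d = ∨-mono (◇C≤-mono m d) (◇C^-mono (suc m) d)

    ◇C≤-refl : ∀ m {φ} → φ ⊢ ◇C≤ C m φ
    ◇C≤-refl zero    = ⊢-refl
    ◇C≤-refl (suc m) = ⊢-trans (◇C≤-refl m) ∨-introˡ

    ◇C-◇C≤ : ∀ m φ → ◇C C (◇C≤ C m φ) ⊢ ◇C≤ C (suc m) φ
    ◇C-◇C≤ zero    φ = ∨-introʳ
    ◇C-◇C≤ (suc m) φ = ⊢-trans (◇C-∨ (◇C≤ C m φ) (◇C^ C (suc m) φ))
      (∨-mono (◇C-◇C≤ m φ) ⊢-refl)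

    ◇C^-closed : ∀ i {φ} → ◇C C φ ⊢ φ → ◇C^ C i φ ⊢ φ
    ◇C^-closed zero    d = ⊢-refl
    ◇C^-closed (suc i) d = ⊢-trans (◇C-mono (◇C^-closed i d)) d

    ◇C≤-closed : ∀ m {φ} → ◇C C φ ⊢ φ → ◇C≤ C m φ ⊢ φ
    ◇C≤-closed zero    d = ⊢-refl
    ◇C≤-closed (suc m) d = ∨-elim (◇C≤-closed m d) (◇C^-closed (suc m) d)

    -- The axiom, substituted from `p 0` to `φ`, makes `◇C≤ C m φ` closed under one step of `◇C`; a
    -- closed formula absorbs all iterates.
    ◇C≤-trans : ∀ m → L (TraAx C m) → ∀ φ → ◇C≤ C m (◇C≤ C m φ) ⊢ ◇C≤ C m φ
    ◇C≤-trans m ax φ = ◇C≤-closed m (⊢-trans (◇C-◇C≤ m φ) (∨-elim ⊢-refl ax-φ))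
      where
      ax-φ : ◇C^ C (suc m) φ ⊢ ◇C≤ C m φ
      ax-φ = subst₂ _⊢_ (sub-◇C^ C (λ _ → φ) (suc m) (p 0)) (sub-◇C≤ C (λ _ → φ) m (p 0))
        (substitution (λ _ → φ) _ ax)

-- Height

sign : ∀ {A : Set} → Bool → Fm A → Fm A
sign true  φ = φ
sign false φ = ¬' φ

even : ℕ → Bool
even zero    = true
even (suc j) = not (even j)

module _ {n : ℕ} (C : Subset n) (m : ℕ) where

  -- The signs count down: a chain of `j` steps meets `x` with the signs `even j`, ..., `even 1` in
  -- this order.
  alternation : ℕ → Fm (Fin n) → Fm (Fin n)
  alternation zero    x = ⊤'
  alternation (suc j) x = ◇C≤ C m (sign (even (suc j)) x ∧' alternation j x)

  sub-alternation : ∀ σ j x → sub σ (alternation j x) ≡ alternation j (sub σ x)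
  sub-alternation σ zero    x = refl
  sub-alternation σ (suc j) x =
    trans (sub-◇C≤ C σ m _)
      (cong (◇C≤ C m) (cong₂ _∧'_ (sub-sign (even (suc j))) (sub-alternation σ j x)))
    where
    sub-sign : ∀ b → sub σ (sign b x) ≡ sign b (sub σ x)
    sub-sign true  = refl
    sub-sign false = refl

  VarsBelow-alternation : ∀ {k} j x → VarsBelow k x → VarsBelow k (alternation j x)
  VarsBelow-alternation zero    x b = tt , tt
  VarsBelow-alternation {k} (suc j) x b =
    VarsBelow-◇C≤ C m _ ((VarsBelow-sign (even (suc j)) , VarsBelow-alternation j x b , tt) , tt)
    where
    VarsBelow-sign : ∀ s → VarsBelow k (sign s x)
    VarsBelow-sign true  = b
    VarsBelow-sign false = b , tt

module Height {n : ℕ} {L : Logic n} (N : Normal L)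
              (C : Subset n) (m : ℕ) (ax : L (TraAx C m)) where
  open Derive N

  private
    ◆ : Fm (Fin n) → Fm (Fin n)
    ◆ = ◇C≤ C m

    E : ℕ → Fm (Fin n) → Fm (Fin n)
    E = alternation C m

    ◆-mono : ∀ {φ ψ} → φ ⊢ ψ → ◆ φ ⊢ ◆ ψ
    ◆-mono = ◇C≤-mono C m

    ◆-refl : ∀ {φ} → φ ⊢ ◆ φ
    ◆-refl = ◇C≤-refl C m

    ◆-trans : ∀ {φ} → ◆ (◆ φ) ⊢ ◆ φ
    ◆-trans = ◇C≤-trans C m ax _

  E-closed : ∀ j x → ◆ (E j x) ⊢ E j x
  E-closed zero    x = prop (p 0 ⇒ ⊤') (◆ ⊤' ∷ [])
  E-closed (suc j) x = ◆-trans

  E-suc : ∀ j x → E (suc j) x ⊢ E j x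
  E-suc j x = ⊢-trans (◆-mono ∧-elimʳ) (E-closed j x)

  E-antitone : ∀ {i j} x → i ≤′ j → E j x ⊢ E i x
  E-antitone x ≤′-refl             = ⊢-refl
  E-antitone x (≤′-step {j} i≤j) = ⊢-trans (E-suc j x) (E-antitone x i≤j)

  u : ℕ → Fm (Fin n)
  u j = ◆ (¬' (B* C m j))

  level : ℕ → Fm (Fin n)
  level j = u j ∧' ¬' (u (suc j))

  -- A refutation of `B*` at `suc j` sees a point satisfying `top`. There `B*` at `j` fails, which
  -- gives `u j`, and `q` is no longer accessible; every refutation at `suc j` makes `q` true, so
  -- `u (suc j)` fails.
  u-level : ∀ j → u (suc j) ⊢ ◆ (level j)
  u-level j = ⊢-trans (◆-mono (⊢-trans ¬B-elim (◆-mono (∧-intro below above)))) ◆-trans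
    where
    q = p (suc j)
    top = ¬' (◆ q ∨' B* C m j)
    ¬B-elim : ¬' (B* C m (suc j)) ⊢ ◆ top
    ¬B-elim = prop (¬' (p 0 ⇒ ¬' (p 1)) ⇒ p 1) (q ∷ ◆ top ∷ [])
    below : top ⊢ u j
    below = ⊢-trans (contrapose ∨-introʳ) ◆-refl
    above : top ⊢ ¬' (u (suc j))
    above = ⊢-trans (contrapose ∨-introˡ)
      (contrapose (◆-mono (prop (¬' (p 0 ⇒ p 1) ⇒ p 0) (q ∷ ¬' (◆ top) ∷ []))))

  u-suc : ∀ j → u (suc j) ⊢ u j
  u-suc j = ⊢-trans (u-level j) (⊢-trans (◆-mono ∧-elimˡ) ◆-trans)

  u-antitone : ∀ {i j} → i ≤′ j → u j ⊢ u i
  u-antitone ≤′-refl           = ⊢-refl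
  u-antitone (≤′-step {j} i≤j) = ⊢-trans (u-suc j) (u-antitone i≤j)

  -- A case distinction from the top down: the largest positive `k` up to the index with `u k`
  -- decides, and `sign s ⊤'` is the truth constant of `s`.
  levelParity : ℕ → Fm (Fin n)
  levelParity zero    = ⊤'
  levelParity (suc j) =
    (u (suc j) ∧' sign (even (suc j)) ⊤') ∨' (¬' (u (suc j)) ∧' levelParity j)

  level⊢parity-same : ∀ j → level j ⊢ sign (even j) (levelParity j)
  level⊢parity-same zero    = prop (p 0 ⇒ ⊤') (level 0 ∷ [])
  level⊢parity-same (suc j) = go (even (suc j))
    where
    go : ∀ s → level (suc j) ⊢
         sign s ((u (suc j) ∧' sign s ⊤') ∨' (¬' (u (suc j)) ∧' levelParity j))
    go true  = prop (p 0 ∧' p 1 ⇒ (p 0 ∧' ⊤') ∨' (¬' (p 0) ∧' p 2))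
      (u (suc j) ∷ ¬' (u (suc (suc j))) ∷ levelParity j ∷ [])
    go false = prop (p 0 ∧' p 1 ⇒ ¬' ((p 0 ∧' ¬' ⊤') ∨' (¬' (p 0) ∧' p 2)))
      (u (suc j) ∷ ¬' (u (suc (suc j))) ∷ levelParity j ∷ [])

  -- At level `j` all `u (suc i)` with `j ≤ i` fail, since `u` is antitone, so the clauses that
  -- `levelParity` adds beyond `j` leave its value unchanged.
  level⊢parity : ∀ {j i} → j ≤′ i → level j ⊢ sign (even j) (levelParity i)
  level⊢parity {j} ≤′-refl = level⊢parity-same j
  level⊢parity {j} (≤′-step {i} j≤i) =
    go (even j) (⊢-trans ∧-elimʳ (contrapose (u-antitone (≤⇒≤′ (s≤s (≤′⇒≤ j≤i))))))
      (level⊢parity j≤i)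
    where
    w = u (suc i)
    c = sign (even (suc i)) ⊤'
    go : ∀ s → level j ⊢ ¬' w → level j ⊢ sign s (levelParity i) →
         level j ⊢ sign s ((w ∧' c) ∨' (¬' w ∧' levelParity i))
    go true  d e = prop ((p 0 ⇒ ¬' (p 1)) ⇒ (p 0 ⇒ p 3) ⇒
                         p 0 ⇒ (p 1 ∧' p 2) ∨' (¬' (p 1) ∧' p 3))
      (level j ∷ w ∷ c ∷ levelParity i ∷ []) · d · e
    go false d e = prop ((p 0 ⇒ ¬' (p 1)) ⇒ (p 0 ⇒ ¬' (p 3)) ⇒
                         p 0 ⇒ ¬' ((p 1 ∧' p 2) ∨' (¬' (p 1) ∧' p 3)))
      (level j ∷ w ∷ c ∷ levelParity i ∷ []) · d · e

  module _ {x : Fm (Fin n)} {i : ℕ} (parity : ∀ {j} → j ≤ i → level j ⊢ sign (even j) x) where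

    -- A point of level `suc j` sees one of level `j`, and `E-closed` brings `E j x` back from
    -- there. Having the right sign itself, the point is its own first step.
    level⊢E : ∀ j → j ≤ i → level j ⊢ E j x
    level⊢E zero    _   = prop (p 0 ⇒ ⊤') (level 0 ∷ [])
    level⊢E (suc j) j<i = ⊢-trans (∧-intro (parity j<i) E-below) ◆-refl
      where
      E-below : level (suc j) ⊢ E j x
      E-below = ⊢-trans ∧-elimˡ (⊢-trans (u-level j)
        (⊢-trans (◆-mono (level⊢E j (≤-trans (n≤1+n j) j<i))) (E-closed j x)))

    -- The first step of `E (suc j) x` reaches a point with `u j`. If `u (suc j)` failed there, its
    -- level would be `j` and `x` would have the opposite sign. Only levels below the index are
    -- consulted, so the bound reaches `suc i`.
    E⊢u : ∀ j → j ≤ suc i → E j x ⊢ u j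
    -- `B* C m 0` is `⊥'`, so `u 0` is `◆ ⊤'` and holds by reflexivity.
    E⊢u zero    _         = prop (p 1 ⇒ p 0 ⇒ p 1) (⊤' ∷ u 0 ∷ []) · (◆-refl · prop ⊤' [])
    E⊢u (suc j) (s≤s j≤i) = ⊢-trans
      (◆-mono (go (even j) (parity j≤i) (E⊢u j (≤-trans j≤i (n≤1+n i))))) ◆-trans
      where
      go : ∀ s → level j ⊢ sign s x → E j x ⊢ u j → sign (not s) x ∧' E j x ⊢ u (suc j)
      go true  d e = prop ((p 0 ∧' ¬' (p 1) ⇒ p 2) ⇒ (p 3 ⇒ p 0) ⇒ ¬' (p 2) ∧' p 3 ⇒ p 1)
        (u j ∷ u (suc j) ∷ x ∷ E j x ∷ []) · d · e
      go false d e = prop ((p 0 ∧' ¬' (p 1) ⇒ ¬' (p 2)) ⇒ (p 3 ⇒ p 0) ⇒ p 2 ∧' p 3 ⇒ p 1)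
        (u j ∷ u (suc j) ∷ x ∷ E j x ∷ []) · d · e

  B*-derivable : ∀ i → (∀ x → E i x ⊢ E (suc i) x) → L (B* C m (suc i))
  B*-derivable i stop = prop ((¬' (p 0) ⇒ ⊥') ⇒ p 0) (B* C m (suc i) ∷ [])
    · ⊢-trans ◆-refl (⊢-trans (u-level i) (⊢-trans (◆-mono level-empty) ◆-⊥))
    where
    x = levelParity i
    parity : ∀ {j} → j ≤ i → level j ⊢ sign (even j) x
    parity j≤i = level⊢parity (≤⇒≤′ j≤i)
    level⊢u : level i ⊢ u (suc i)
    level⊢u = ⊢-trans (level⊢E parity i ≤-refl) (⊢-trans (stop x) (E⊢u parity (suc i) ≤-refl))
    level-empty : level i ⊢ ⊥'
    level-empty = prop ((p 0 ∧' ¬' (p 1) ⇒ p 1) ⇒ p 0 ∧' ¬' (p 1) ⇒ ⊥')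
      (u i ∷ u (suc i) ∷ []) · level⊢u
    ◆-⊥ : ◆ ⊥' ⊢ ⊥'
    ◆-⊥ = ◇C≤-closed C m (◇C-⊥ C)

  -- Among `suc (length reps)` formulas `E j (p 0)` two share a representative, say at `i < j`. The
  -- sequence descends, so `E i` implies `E j` and hence `E (suc i)`.
  one-finite⇒B* : KFinite L 1 → ∃ λ h → L (B* C m h)
  one-finite⇒B* (reps , _ , classify) = suc (toℕ i) , B*-derivable (toℕ i) stop
    where
    rep : ∀ j → Σ _ λ ψ → ψ ∈ reps × E j (p 0) ≈ ψ
    rep j = classify (E j (p 0)) (VarsBelow-alternation C m j (p 0) (s≤s z≤n))
    index : Fin (suc (length reps)) → Fin (length reps)
    index j = Any.index (proj₁ (proj₂ (rep (toℕ j))))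
    collision = pigeonhole (n<1+n (length reps)) index
    i = proj₁ collision
    j = proj₁ (proj₂ collision)
    i<j = proj₁ (proj₂ (proj₂ collision))
    same-rep : proj₁ (rep (toℕ i)) ≡ proj₁ (rep (toℕ j))
    same-rep = trans (Any.lookup-index (proj₁ (proj₂ (rep (toℕ i)))))
      (trans (cong (lookup reps) (proj₂ (proj₂ (proj₂ collision))))
        (sym (Any.lookup-index (proj₁ (proj₂ (rep (toℕ j)))))))
    stop₀ : E (toℕ i) (p 0) ⊢ E (suc (toℕ i)) (p 0)
    stop₀ = ⊢-trans
      (≈⇒⊢ (≈-trans (proj₂ (proj₂ (rep (toℕ i))))
        (≈-sym (subst (E (toℕ j) (p 0) ≈_) (sym same-rep) (proj₂ (proj₂ (rep (toℕ j))))))))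
      (E-antitone (p 0) (≤⇒≤′ i<j))
    -- Substitution for `p 0` carries the implication from one variable to arbitrary `x`, in
    -- particular to `levelParity`.
    stop : ∀ x → E (toℕ i) x ⊢ E (suc (toℕ i)) x
    stop x = subst₂ _⊢_ (sub-alternation C m (λ _ → x) (toℕ i) (p 0))
      (sub-alternation C m (λ _ → x) (suc (toℕ i)) (p 0))
      (Normal.subst N (λ _ → x) _ stop₀)

-- Finitely generated subalgebras of a finite algebra

funToFin-cong : ∀ {m n} {f g : Fin m → Fin n} → f ≗ g → funToFin f ≡ funToFin g
funToFin-cong {zero}  h = refl
funToFin-cong {suc m} h = cong₂ Fin.combine (h Fin.zero) (funToFin-cong (h ∘ Fin.suc))

-- The assumptions make the kernel of `code` a congruence with at most `M` classes. Which classes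
-- contain formulas in `k` variables is found by adding formulas one at a time.
module Saturation {n M : ℕ} (k : ℕ) (code : Fm (Fin n) → Fin M)
  (code-⇒ : ∀ {φ φ′ ψ ψ′} → code φ ≡ code φ′ → code ψ ≡ code ψ′ →
            code (φ ⇒ ψ) ≡ code (φ′ ⇒ ψ′))
  (code-◇ : ∀ {a φ φ′} → code φ ≡ code φ′ → code (◇ a φ) ≡ code (◇ a φ′)) where

  atoms : List (Fm (Fin n))
  atoms = ⊥' ∷ map (var ∘ toℕ) (allFin k)

  next : List (Fm (Fin n)) → List (Fm (Fin n))
  next S = atoms ++ cartesianProductWith _⇒_ S S ++ cartesianProductWith ◇ (allFin n) S

  Covered : List (Fm (Fin n)) → Fm (Fin n) → Set
  Covered S φ = Any (λ ψ → code φ ≡ code ψ) S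

  atoms-below : All (VarsBelow k) atoms
  atoms-below = tt ∷ All.map⁺ {xs = allFin k} {f = var ∘ toℕ} (All.tabulate λ {i} _ → toℕ<n i)

  next-below : ∀ S → All (VarsBelow k) S → All (VarsBelow k) (next S)
  next-below S b = All.++⁺ {xs = atoms} atoms-below
    (All.++⁺
      (All.cartesianProductWith⁺ (setoid _) (setoid _) _⇒_ S S
        λ φ∈S ψ∈S → All.lookup b φ∈S , All.lookup b ψ∈S)
      (All.cartesianProductWith⁺ (setoid _) (setoid _) ◇ (allFin n) S λ _ φ∈S → All.lookup b φ∈S))

  -- Subformulas are replaced by members of `S` with the same code; a connective applied to members
  -- lies in `next S`.
  closed-covers : ∀ S → All (Covered S) (next S) → ∀ φ → VarsBelow k φ → Covered S φ
  closed-covers S closed = go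
    where
    go : ∀ φ → VarsBelow k φ → Covered S φ
    go (var i) i<k = All.lookup closed (∈-++⁺ˡ (there
      (subst (λ j → var j ∈ map (var ∘ toℕ) (allFin k)) (toℕ-fromℕ< i<k)
        (∈-map⁺ (var ∘ toℕ) (∈-allFin (fromℕ< i<k))))))
    go ⊥' _ = All.lookup closed (here refl)
    go (φ ⇒ ψ) (b , c) with find (go φ b) | find (go ψ c)
    ... | φ′ , φ′∈S , eq | ψ′ , ψ′∈S , eq′ =
      Any.map (trans (code-⇒ eq eq′)) (All.lookup closed
        (∈-++⁺ʳ atoms (∈-++⁺ˡ (∈-cartesianProductWith⁺ _⇒_ φ′∈S ψ′∈S))))
    go (◇ a φ) b with find (go φ b)
    ... | φ′ , φ′∈S , eq =
      Any.map (trans (code-◇ eq)) (All.lookup closed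
        (∈-++⁺ʳ atoms (∈-++⁺ʳ (cartesianProductWith _⇒_ S S)
          (∈-cartesianProductWith⁺ ◇ (∈-allFin a) φ′∈S))))

  -- `free` contains all codes not yet covered. Each round adds a formula with a new code and
  -- deletes that code from `free`, so the length of `free` decreases.
  saturate : ∀ S → All (VarsBelow k) S → (free : List (Fin M)) →
             (∀ c → c ∈ free ⊎ Any (λ ψ → c ≡ code ψ) S) → Acc _<_ (length free) →
             Σ (List (Fm (Fin n))) λ R → All (VarsBelow k) R × (∀ φ → VarsBelow k φ → Covered R φ)
  saturate S b free inv (acc rs) with all? (λ φ → any? (λ ψ → code φ ≟ code ψ) S) (next S)
  ... | yes closed = S , b , closed-covers S closed
  ... | no ¬closed
    with χ , χ∈next , new ← find (All.¬All⇒Any¬ (λ φ → any? (λ ψ → code φ ≟ code ψ) S) _ ¬closed)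
    = saturate (χ ∷ S) (All.lookup (next-below S b) χ∈next ∷ b) (filter other? free) inv′
        (rs (filter-notAll other? free (lose χ-free λ ne → ne refl)))
    where
    other? = λ c → ¬? (c ≟ code χ)
    χ-free : code χ ∈ free
    χ-free with inv (code χ)
    ... | inj₁ c∈free = c∈free
    ... | inj₂ old    = contradiction old new
    inv′ : ∀ c → c ∈ filter other? free ⊎ Any (λ ψ → c ≡ code ψ) (χ ∷ S)
    inv′ c with c ≟ code χ | inv c
    ... | yes eq | _           = inj₂ (here eq)
    ... | no  ne | inj₁ c∈free = inj₁ (∈-filter⁺ other? c∈free ne)
    ... | no  ne | inj₂ old    = inj₂ (there old)

  generators : Σ (List (Fm (Fin n))) λ R → All (VarsBelow k) R × (∀ φ → VarsBelow k φ → Covered R φ)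
  generators = saturate [] [] (allFin M) (λ c → inj₁ (∈-allFin c)) (<-wellFounded _)

-- The logic of the one-generated free algebra

oneGenerated : ∀ {n} → Logic n → Logic n
oneGenerated L φ = ∀ σ → (∀ i → VarsBelow 1 (σ i)) → L (sub σ φ)

module OneGenerated {n : ℕ} {L : Logic n} (N : Normal L) where
  open Normal N renaming (subst to substitution)

  ⊆-oneGenerated : ∀ φ → L φ → oneGenerated L φ
  ⊆-oneGenerated φ d σ _ = substitution σ φ d

  -- The constant substitution `p 0` is admissible and fixes formulas in the variable `p 0`.
  oneGenerated⇒ : ∀ {φ} → VarsBelow 1 φ → oneGenerated L φ → L φ
  oneGenerated⇒ {φ} b d = subst L (sub-var (λ _ → p 0) (λ { zero _ → refl ; (suc _) (s≤s ()) }) φ b)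
    (d (λ _ → p 0) (λ _ → s≤s z≤n))

  oneGenerated-normal : Normal (oneGenerated L)
  oneGenerated-normal = record
    { taut  = λ φ t → ⊆-oneGenerated φ (taut φ t)
    ; dual  = λ a → ⊆-oneGenerated _ (dual a)
    ; distr = λ a → ⊆-oneGenerated _ (distr a)
    ; mp    = λ φ ψ d e σ b → mp _ _ (d σ b) (e σ b)
    ; subst = λ τ φ d σ b → subst L (sym (sub-sub σ τ φ))
                (d (sub σ ∘ τ) (λ i → VarsBelow-sub σ b (τ i)))
    ; mono  = λ a φ ψ d σ b → mono a _ _ (d σ b)
    }

  module _ (fin : KFinite L 1) where
    open Derive N using (_≈_; ≈-sym; ≈-trans; ⇒-cong; ◇-cong)

    private
      reps = proj₁ fin
      classify = proj₂ (proj₂ fin)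
      K = length reps

    rep : Fin K → Fm (Fin n)
    rep = lookup reps

    rep-below : ∀ i → VarsBelow 1 (rep i)
    rep-below i = proj₁ (proj₂ fin) _ (∈-lookup i)

    index : ∀ φ → VarsBelow 1 φ → Fin K
    index φ b = Any.index (proj₁ (proj₂ (classify φ b)))

    ≈-rep-index : ∀ φ b → φ ≈ rep (index φ b)
    ≈-rep-index φ b = subst (φ ≈_) (Any.lookup-index (proj₁ (proj₂ (classify φ b))))
      (proj₂ (proj₂ (classify φ b)))

    -- The elements are positions in `reps`, and several positions may hold equivalent formulas.
    -- Equality of values is thus decidable, while equivalence in `L` need not be.
    ⟦_⟧ : Fm (Fin n) → (ℕ → Fin K) → Fin K
    ⟦ var i ⟧ ρ = ρ i
    ⟦ ⊥'    ⟧ ρ = index ⊥' tt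
    ⟦ φ ⇒ ψ ⟧ ρ = index (rep (⟦ φ ⟧ ρ) ⇒ rep (⟦ ψ ⟧ ρ)) (rep-below _ , rep-below _)
    ⟦ ◇ a φ ⟧ ρ = index (◇ a (rep (⟦ φ ⟧ ρ))) (rep-below _)

    ⟦⟧-local : ∀ {k ρ ρ′} → (∀ i → i < k → ρ i ≡ ρ′ i) →
               ∀ φ → VarsBelow k φ → ⟦ φ ⟧ ρ ≡ ⟦ φ ⟧ ρ′
    ⟦⟧-local h (var i) b       = h i b
    ⟦⟧-local h ⊥'      b       = refl
    ⟦⟧-local h (φ ⇒ ψ) (b , c) =
      cong₂ (λ i j → index (rep i ⇒ rep j) (rep-below i , rep-below j))
        (⟦⟧-local h φ b) (⟦⟧-local h ψ c)
    ⟦⟧-local h (◇ a φ) b       = cong (λ i → index (◇ a (rep i)) (rep-below i)) (⟦⟧-local h φ b)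

    sub-≈-⟦⟧ : ∀ σ (b : ∀ i → VarsBelow 1 (σ i)) φ →
               sub σ φ ≈ rep (⟦ φ ⟧ (λ i → index (σ i) (b i)))
    sub-≈-⟦⟧ σ b (var i) = ≈-rep-index (σ i) (b i)
    sub-≈-⟦⟧ σ b ⊥'      = ≈-rep-index ⊥' tt
    sub-≈-⟦⟧ σ b (φ ⇒ ψ) = ≈-trans (⇒-cong (sub-≈-⟦⟧ σ b φ) (sub-≈-⟦⟧ σ b ψ)) (≈-rep-index _ _)
    sub-≈-⟦⟧ σ b (◇ a φ) = ≈-trans (◇-cong (sub-≈-⟦⟧ σ b φ)) (≈-rep-index _ _)

    module _ (k : ℕ) where

      -- The assignments to the first `k` variables, extended by a fixed default that formulas in
      -- these variables never read.
      env : Fin (K ^ k) → ℕ → Fin K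
      env e i with i <? k
      ... | yes i<k = finToFun e (fromℕ< i<k)
      ... | no  _   = index ⊥' tt

      env-surjective : ∀ (ρ : ℕ → Fin K) i → i < k → ρ i ≡ env (funToFin (ρ ∘ toℕ {k})) i
      env-surjective ρ i i<k with i <? k
      ... | yes i<k′ = sym (trans (finToFun-funToFin (ρ ∘ toℕ) (fromℕ< i<k′))
                              (cong ρ (toℕ-fromℕ< i<k′)))
      ... | no  i≮k  = contradiction i<k i≮k

      -- The value table of `φ` over all `K ^ k` assignments, packed into one number.
      code : Fm (Fin n) → Fin (K ^ (K ^ k))
      code φ = funToFin (λ e → ⟦ φ ⟧ (env e))

      code-injective : ∀ {φ ψ} → code φ ≡ code ψ → ∀ e → ⟦ φ ⟧ (env e) ≡ ⟦ ψ ⟧ (env e)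
      code-injective eq e = trans (sym (finToFun-funToFin _ e))
        (trans (cong (λ c → finToFun c e) eq) (finToFun-funToFin _ e))

      code-⇒ : ∀ {φ φ′ ψ ψ′} → code φ ≡ code φ′ → code ψ ≡ code ψ′ → code (φ ⇒ ψ) ≡ code (φ′ ⇒ ψ′)
      code-⇒ {φ} {φ′} {ψ} {ψ′} eq eq′ = funToFin-cong λ e →
        cong₂ (λ i j → index (rep i ⇒ rep j) (rep-below i , rep-below j))
          (code-injective {φ} {φ′} eq e) (code-injective {ψ} {ψ′} eq′ e)

      code-◇ : ∀ {a φ φ′} → code φ ≡ code φ′ → code (◇ a φ) ≡ code (◇ a φ′)
      code-◇ {a} {φ} {φ′} eq = funToFin-cong λ e →
        cong (λ i → index (◇ a (rep i)) (rep-below i)) (code-injective {φ} {φ′} eq e)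

      -- A one-variable substitution induces an assignment that agrees below `k` with a listed one.
      -- Equal codes give equal values there, and `sub-≈-⟦⟧` turns these into equivalent instances.
      code-≈ : ∀ {φ ψ} → VarsBelow k φ → VarsBelow k ψ → code φ ≡ code ψ → φ ≈[ oneGenerated L ] ψ
      code-≈ {φ} {ψ} b c eq σ s = ≈-trans (sub-≈-⟦⟧ σ s φ)
        (subst (λ i → rep i ≈ sub σ ψ) (sym same) (≈-sym (sub-≈-⟦⟧ σ s ψ)))
        where
        ρ = λ i → index (σ i) (s i)
        same : ⟦ φ ⟧ ρ ≡ ⟦ ψ ⟧ ρ
        same = trans (⟦⟧-local (env-surjective ρ) φ b)
          (trans (code-injective {φ} {ψ} eq _) (sym (⟦⟧-local (env-surjective ρ) ψ c)))

      oneGenerated-kFinite : KFinite (oneGenerated L) k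
      oneGenerated-kFinite
        with R , below , covers ← Saturation.generators k code
               (λ {φ} {φ′} {ψ} {ψ′} → code-⇒ {φ} {φ′} {ψ} {ψ′})
               (λ {a} {φ} {φ′} → code-◇ {a} {φ} {φ′})
        = R , (λ ψ ψ∈R → All.lookup below ψ∈R) , λ φ b →
            let ψ , ψ∈R , eq = find (covers φ b)
            in ψ , ψ∈R , code-≈ {φ} {ψ} b (All.lookup below ψ∈R) eq

-- From the one-generated logic back to `L`

theorem3p14 : (n : ℕ) (L₀ : Logic n) → Normal L₀ →
    FiniteHeightCriterion L₀ → OneFinitenessCondition L₀
theorem3p14 n L₀ _ criterion L ext fin = proj₂ (criterion L ext) finiteHeight
  where
  N = Extension.normal ext
  open OneGenerated N
  ext₁ : Extension L₀ (oneGenerated L)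
  ext₁ = record
    { normal   = oneGenerated-normal
    ; contains = λ d → ⊆-oneGenerated _ (Extension.contains ext d)
    }
  finiteHeight : ∀ C → FiniteHeight C L
  -- Membership of the one-variable `TraAx` passes both ways between the two logics, so they share
  -- the least `m`. The formula `B*` has other variables; its membership in `L` comes from the
  -- 1-finiteness of `L`.
  finiteHeight C with m , (ax , least) , _ ← proj₁ (criterion _ ext₁) (oneGenerated-kFinite fin) C
    = m
    , (axL , λ m′ m′<m d → least m′ m′<m (⊆-oneGenerated _ d))
    , Height.one-finite⇒B* N C m axL fin
    where
    axL = oneGenerated⇒ (VarsBelow-TraAx C m) ax
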